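{- Let $G_1$, $G_2$ and $G_3$ be three pairwise disjoint connected graphs and let $x_i\in V(G_i)$ for $i\in\{1,2,3\}$. Let $B(G_1,G_2,G_3)$ be the bouquet of the graphs $G_1,G_2,G_3$ with respect to the vertices $x_1,x_2,x_3$, i.e. the graph obtained from the disjoint union of $G_1,G_2,G_3$ by identifying $x_1,x_2,x_3$ to a single vertex. Then $$\gamma_{sp}(G_1)+\gamma_{sp}(G_2)+\gamma_{sp}(G_3)-2\leq \gamma_{sp}(B(G_1,G_2,G_3))\leq \gamma_{sp}(G_1)+\gamma_{sp}(G_2)+\gamma_{sp}(G_3).$$
   Context: All graphs are finite, simple and undirected. $N(v)$ denotes the open neighbourhood of $v$. For a graph $G=(V,E)$ and $S\subseteq V$ write $\overline{S}=V\setminus S$. A set $S\subseteq V$ is dominating if every vertex of $\overline{S}$ is adjacent to at least one vertex of $S$. A dominating set $S$ is a super dominating set of $G$ if for every $u\in\overline{S}$ there exists $w\in S$ with $N(w)\cap\overline{S}=\{u\}$. The super domination number $\gamma_{sp}(G)$ is the minimum cardinality of a super dominating set of $G$. -}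

module Defs where

open import Data.Empty using (⊥-elim)
open import Data.Fin using (Fin; zero; suc; join; splitAt; punchIn; punchOut; _≟_)
open import Data.Fin.Properties
  using (any?; all?; join-splitAt; splitAt-join; punchIn-punchOut; punchOut-punchIn;
         punchOut-cong; punchInᵢ≢i; suc-injective)
open import Data.Fin.Subset using (Subset; _∈_; _∩_; ∁; ⁅_⁆; ∣_∣; ⊤)
open import Data.Fin.Subset.Properties using (_∈?_; anySubset?; ∈⊤; x∈p⇒x∉∁p)
import Data.Bool.Properties as Bool
open import Data.Nat using (ℕ; zero; suc; _+_; _≤_; z≤n; s≤s)
import Data.Nat.Properties as ℕ
open import Data.Product using (∃; ∃₂; _×_; _,_; proj₁; proj₂)
open import Data.Sum as Sum using (_⊎_; inj₁; inj₂)
open import Data.Sum.Relation.Binary.Pointwise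
  using (Pointwise; inj₁; inj₂; ⊎-symmetric; ⊎-decidable)
open import Data.Vec using (tabulate)
open import Data.Vec.Properties using (≡-dec)
open import Function using (_∘_; _⇔_; mk⇔; module Equivalence)
open import Level using (0ℓ)
open import Relation.Binary using (Rel; Symmetric; Irreflexive) renaming (Decidable to Decidable₂)
open import Relation.Binary.Construct.Closure.ReflexiveTransitive using (Star)
open import Relation.Binary.PropositionalEquality
  using (_≡_; refl; sym; trans; cong; module ≡-Reasoning)
open import Relation.Nullary using (¬_; Dec; yes; no; does)
open import Relation.Nullary.Decidable using (map′; _×-dec_; _⊎-dec_; _→-dec_)
open import Relation.Unary using (Decidable)

record Graph (n : ℕ) : Set₁ where
  field
    Adj         : Rel (Fin n) 0ℓ
    adj?        : Decidable₂ Adj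
    adj-sym     : Symmetric Adj
    adj-irrefl  : Irreflexive _≡_ Adj

  N : Fin n → Subset n
  N v = tabulate (λ u → does (adj? v u))

Connected : ∀ {n} → Graph n → Set
Connected G = ∀ u v → Star (Graph.Adj G) u v

module _ {n : ℕ} (G : Graph n) where
  open Graph G

  Dominating : Subset n → Set
  Dominating S = ∀ u → u ∈ ∁ S → ∃ λ w → w ∈ S × Adj u w

  SuperDominating : Subset n → Set
  SuperDominating S =
    Dominating S × (∀ u → u ∈ ∁ S → ∃ λ w → w ∈ S × N w ∩ ∁ S ≡ ⁅ u ⁆)

  IsSuperDominationNumber : ℕ → Set
  IsSuperDominationNumber k =
    (∃ λ S → SuperDominating S × ∣ S ∣ ≡ k) × (∀ S → SuperDominating S → k ≤ ∣ S ∣)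

  superDominating? : Decidable SuperDominating
  superDominating? S =
    all? (λ u → u ∈? ∁ S →-dec any? (λ w → w ∈? S ×-dec adj? u w))
    ×-dec
    all? (λ u → u ∈? ∁ S →-dec
      any? (λ w → w ∈? S ×-dec ≡-dec Bool._≟_ (N w ∩ ∁ S) ⁅ u ⁆))

  superDominating-⊤ : SuperDominating ⊤
  superDominating-⊤ =
    (λ _ u∈ → ⊥-elim (x∈p⇒x∉∁p ∈⊤ u∈)) , (λ _ u∈ → ⊥-elim (x∈p⇒x∉∁p ∈⊤ u∈))

least : {P : ℕ → Set} → Decidable P → ∀ n → P n →
        ∃ λ k → P k × (∀ j → P j → k ≤ j)
least P? zero    p = zero , p , λ _ _ → z≤n
least {P} P? (suc n) p with P? zero
... | yes p₀ = zero , p₀ , λ _ _ → z≤n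
... | no ¬p₀ with least (P? ∘ suc) n p
...   | k , pk , k-min = suc k , pk , bound
  where
  bound : ∀ j → P j → suc k ≤ j
  bound zero    p₀ = ⊥-elim (¬p₀ p₀)
  bound (suc j) pj = s≤s (k-min j pj)

superDominationNumber : ∀ {n} (G : Graph n) → ∃ (IsSuperDominationNumber G)
superDominationNumber {n} G
  with least (λ k → anySubset? (λ S → superDominating? G S ×-dec (∣ S ∣ ℕ.≟ k)))
             ∣ ⊤ {n} ∣ (⊤ , superDominating-⊤ G , refl)
... | k , attained , k-min = k , attained , λ S sd → k-min ∣ S ∣ (S , sd , refl)

γsp : ∀ {n} → Graph n → ℕ
γsp G = proj₁ (superDominationNumber G)

-- A graph containing a distinguished vertex has order suc n.  The bouquet is the
-- quotient of the disjoint union by "p ≡ q, or p and q are both roots", realised on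
-- Fin (suc (n₁ + (n₂ + n₃))): zero is the merged vertex and suc numbers the others.
-- identify is the quotient map; see identify-kernel and identify-surjective.
module Bouquet
  {n₁ n₂ n₃ : ℕ}
  (G₁ : Graph (suc n₁)) (x₁ : Fin (suc n₁))
  (G₂ : Graph (suc n₂)) (x₂ : Fin (suc n₂))
  (G₃ : Graph (suc n₃)) (x₃ : Fin (suc n₃))
  where

  private
    module G₁ = Graph G₁
    module G₂ = Graph G₂
    module G₃ = Graph G₃

  V⊎ : Set
  V⊎ = Fin (suc n₁) ⊎ (Fin (suc n₂) ⊎ Fin (suc n₃))

  Adj⊎ : Rel V⊎ 0ℓ
  Adj⊎ = Pointwise G₁.Adj (Pointwise G₂.Adj G₃.Adj)

  data Root : V⊎ → Set where
    root₁ : Root (inj₁ x₁)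
    root₂ : Root (inj₂ (inj₁ x₂))
    root₃ : Root (inj₂ (inj₂ x₃))

  Other : Set
  Other = Fin n₁ ⊎ (Fin n₂ ⊎ Fin n₃)

  number : Other → Fin (n₁ + (n₂ + n₃))
  number = join n₁ (n₂ + n₃) ∘ Sum.map₂ (join n₂ n₃)

  V : Set
  V = Fin (suc (n₁ + (n₂ + n₃)))

  collapse : ∀ {n} → Fin (suc n) → (Fin n → Other) → Fin (suc n) → V
  collapse x ι v with x ≟ v
  ... | yes _  = zero
  ... | no x≢v = suc (number (ι (punchOut x≢v)))

  identify : V⊎ → V
  identify (inj₁ v)        = collapse x₁ inj₁ v
  identify (inj₂ (inj₁ v)) = collapse x₂ (λ k → inj₂ (inj₁ k)) v
  identify (inj₂ (inj₂ v)) = collapse x₃ (λ k → inj₂ (inj₂ k)) v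

  BouquetAdj : Rel V 0ℓ
  BouquetAdj a b = ∃₂ λ p q → identify p ≡ a × identify q ≡ b × Adj⊎ p q

  other : Other → V⊎
  other = Sum.map (punchIn x₁) (Sum.map (punchIn x₂) (punchIn x₃))

  unnumber : Fin (n₁ + (n₂ + n₃)) → Other
  unnumber = Sum.map₂ (splitAt n₂) ∘ splitAt n₁

  unnumber-number : ∀ o → unnumber (number o) ≡ o
  unnumber-number o = trans
    (cong (Sum.map₂ (splitAt n₂)) (splitAt-join n₁ (n₂ + n₃) (Sum.map₂ (join n₂ n₃) o)))
    (inner o)
    where
    inner : ∀ o → Sum.map₂ (splitAt n₂) (Sum.map₂ (join n₂ n₃) o) ≡ o
    inner (inj₁ _) = refl
    inner (inj₂ o) = cong inj₂ (splitAt-join n₂ n₃ o)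

  number-unnumber : ∀ k → number (unnumber k) ≡ k
  number-unnumber k = trans
    (cong (join n₁ (n₂ + n₃)) (inner (splitAt n₁ k)))
    (join-splitAt n₁ (n₂ + n₃) k)
    where
    inner : ∀ s → Sum.map₂ (join n₂ n₃) (Sum.map₂ (splitAt n₂) s) ≡ s
    inner (inj₁ _) = refl
    inner (inj₂ k) = cong inj₂ (join-splitAt n₂ n₃ k)

  collapse-root : ∀ {n} x (ι : Fin n → Other) → collapse x ι x ≡ zero
  collapse-root x ι with x ≟ x
  ... | yes _  = refl
  ... | no x≢x = ⊥-elim (x≢x refl)

  collapse-other : ∀ {n} x (ι : Fin n → Other) k →
                   collapse x ι (punchIn x k) ≡ suc (number (ι k))
  collapse-other x ι k with x ≟ punchIn x k
  ... | yes x≡ = ⊥-elim (punchInᵢ≢i x k (sym x≡))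
  ... | no x≢  = cong (suc ∘ number ∘ ι) (trans (punchOut-cong x refl) (punchOut-punchIn x))

  identify-root : ∀ {p} → Root p → identify p ≡ zero
  identify-root root₁ = collapse-root x₁ _
  identify-root root₂ = collapse-root x₂ _
  identify-root root₃ = collapse-root x₃ _

  identify-other : ∀ o → identify (other o) ≡ suc (number o)
  identify-other (inj₁ k)        = collapse-other x₁ _ k
  identify-other (inj₂ (inj₁ k)) = collapse-other x₂ _ k
  identify-other (inj₂ (inj₂ k)) = collapse-other x₃ _ k

  root-or-other : ∀ p → Root p ⊎ ∃ λ o → other o ≡ p
  root-or-other (inj₁ v) with x₁ ≟ v
  ... | yes refl = inj₁ root₁
  ... | no x≢v   = inj₂ (inj₁ (punchOut x≢v) , cong inj₁ (punchIn-punchOut x≢v))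
  root-or-other (inj₂ (inj₁ v)) with x₂ ≟ v
  ... | yes refl = inj₁ root₂
  ... | no x≢v   = inj₂ (inj₂ (inj₁ (punchOut x≢v)) , cong (λ k → inj₂ (inj₁ k)) (punchIn-punchOut x≢v))
  root-or-other (inj₂ (inj₂ v)) with x₃ ≟ v
  ... | yes refl = inj₁ root₃
  ... | no x≢v   = inj₂ (inj₂ (inj₂ (punchOut x≢v)) , cong (λ k → inj₂ (inj₂ k)) (punchIn-punchOut x≢v))

  identify-kernel : ∀ p q → identify p ≡ identify q ⇔ (p ≡ q ⊎ (Root p × Root q))
  identify-kernel p q = mk⇔ (to p q) from
    where
    to : ∀ p q → identify p ≡ identify q → p ≡ q ⊎ (Root p × Root q)
    to p q eq with root-or-other p | root-or-other q
    ... | inj₁ rp         | inj₁ rq         = inj₂ (rp , rq)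
    ... | inj₁ rp         | inj₂ (o , refl)
      with () ← trans (sym (identify-root rp)) (trans eq (identify-other o))
    ... | inj₂ (o , refl) | inj₁ rq
      with () ← trans (sym (identify-root rq)) (trans (sym eq) (identify-other o))
    ... | inj₂ (o , refl) | inj₂ (o′ , refl) = inj₁ (cong other (begin
      o                     ≡⟨ unnumber-number o ⟨
      unnumber (number o)   ≡⟨ cong unnumber (suc-injective
                                 (trans (sym (identify-other o)) (trans eq (identify-other o′)))) ⟩
      unnumber (number o′)  ≡⟨ unnumber-number o′ ⟩
      o′                    ∎))
      where open ≡-Reasoning

    from : p ≡ q ⊎ (Root p × Root q) → identify p ≡ identify q
    from (inj₁ refl)      = refl
    from (inj₂ (rp , rq)) = trans (identify-root rp) (sym (identify-root rq))

  identify-surjective : ∀ a → ∃ λ p → identify p ≡ a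
  identify-surjective zero    = inj₁ x₁ , identify-root root₁
  identify-surjective (suc k) =
    other (unnumber k) , trans (identify-other (unnumber k)) (cong suc (number-unnumber k))

  adj⊎-irrefl : ∀ {p} → ¬ Adj⊎ p p
  adj⊎-irrefl (inj₁ e)        = G₁.adj-irrefl refl e
  adj⊎-irrefl (inj₂ (inj₁ e)) = G₂.adj-irrefl refl e
  adj⊎-irrefl (inj₂ (inj₂ e)) = G₃.adj-irrefl refl e

  roots-nonadjacent : ∀ {p q} → Root p → Root q → ¬ Adj⊎ p q
  roots-nonadjacent root₁ root₁ e = adj⊎-irrefl e
  roots-nonadjacent root₂ root₂ e = adj⊎-irrefl e
  roots-nonadjacent root₃ root₃ e = adj⊎-irrefl e
  roots-nonadjacent root₁ root₂ ()
  roots-nonadjacent root₁ root₃ ()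
  roots-nonadjacent root₂ root₁ ()
  roots-nonadjacent root₂ root₃ (inj₂ ())
  roots-nonadjacent root₃ root₁ ()
  roots-nonadjacent root₃ root₂ (inj₂ ())

  anyV⊎? : {P : V⊎ → Set} → Decidable P → Dec (∃ P)
  anyV⊎? {P} P? = map′ to from
    (any? (λ v → P? (inj₁ v))
      ⊎-dec (any? (λ v → P? (inj₂ (inj₁ v))) ⊎-dec any? (λ v → P? (inj₂ (inj₂ v)))))
    where
    Split : Set
    Split = ∃ (λ v → P (inj₁ v))
          ⊎ (∃ (λ v → P (inj₂ (inj₁ v))) ⊎ ∃ (λ v → P (inj₂ (inj₂ v))))

    to : Split → ∃ P
    to (inj₁ (v , p))        = inj₁ v , p
    to (inj₂ (inj₁ (v , p))) = inj₂ (inj₁ v) , p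
    to (inj₂ (inj₂ (v , p))) = inj₂ (inj₂ v) , p

    from : ∃ P → Split
    from (inj₁ v , p)        = inj₁ (v , p)
    from (inj₂ (inj₁ v) , p) = inj₂ (inj₁ (v , p))
    from (inj₂ (inj₂ v) , p) = inj₂ (inj₂ (v , p))

  bouquet : Graph (suc (n₁ + (n₂ + n₃)))
  bouquet = record
    { Adj        = BouquetAdj
    ; adj?       = λ a b → anyV⊎? λ p → anyV⊎? λ q →
        identify p ≟ a ×-dec (identify q ≟ b ×-dec adj⊎? p q)
    ; adj-sym    = λ (p , q , eq , eq′ , e) → q , p , eq′ , eq , adj⊎-sym e
    ; adj-irrefl = irrefl
    }
    where
    adj⊎? : Decidable₂ Adj⊎
    adj⊎? = ⊎-decidable G₁.adj? (⊎-decidable G₂.adj? G₃.adj?)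

    adj⊎-sym : Symmetric Adj⊎
    adj⊎-sym = ⊎-symmetric G₁.adj-sym (⊎-symmetric G₂.adj-sym G₃.adj-sym)

    irrefl : Irreflexive _≡_ BouquetAdj
    irrefl refl (p , q , eq , eq′ , e)
      with Equivalence.to (identify-kernel p q) (trans eq (sym eq′))
    ... | inj₁ refl      = adj⊎-irrefl e
    ... | inj₂ (rp , rq) = roots-nonadjacent rp rq e

open Bouquet public using (bouquet)

{-# OPTIONS --safe #-}
-- In a super dominating set S choose for every u outside S a private witness w(u) in S.
-- The vertices outside S and their witnesses play symmetric roles: the only edges between
-- the two sets are the edges u w(u), so the complement of the witnesses is again super
-- dominating, of the same size.  Hence every graph has a minimum super dominating set
-- containing a given vertex x.  For the upper bound take such sets in the three graphs and
-- glue them at the merged vertex; only x used as a witness causes a conflict, which adding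
-- one vertex to the set repairs, and at most two of the three sets need this.
-- For the lower bound restrict a super dominating set S of the bouquet to the three graphs;
-- when the merged vertex is outside S, add it to the two restrictions that miss its witness.
module Submission where

open import Data.Bool using (Bool)
open import Data.Fin using (Fin; zero; suc; punchIn; punchOut; _≟_)
open import Data.Fin.Patterns using (0F; 1F; 2F)
open import Data.Fin.Properties using (any?; punchIn-punchOut; suc-injective)
open import Data.Fin.Subset using (Subset; inside; outside; _∈_; _∉_; _∩_; _∪_; _-_; ∁; ⁅_⁆; ∣_∣)
open import Data.Fin.Subset.Properties
open import Data.Nat using (ℕ; suc; _+_; _∸_; _≤_; z≤n; s≤s)
import Data.Nat.Properties as ℕ
open import Data.Nat.Solver using (module +-*-Solver)
open import Data.Product using (∃; ∃₂; _×_; _,_; proj₁; proj₂)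
open import Data.Sum using (_⊎_; inj₁; inj₂; [_,_]′)
import Data.Sum.Relation.Binary.Pointwise as Pointwise
open import Data.Vec using ([]; _∷_; _++_; lookup; tabulate; insertAt; removeAt; splitAt; here; there)
open import Data.Vec.Properties
  using (lookup⇒[]=; []=⇒lookup; lookup∘tabulate; lookup-++ˡ; lookup-++ʳ;
         insertAt-lookup; insertAt-punchIn; insertAt-removeAt)
open import Function using (_∘_; module Equivalence)
open import Relation.Binary using (DecidableEquality)
open import Relation.Binary.PropositionalEquality
  using (_≡_; _≢_; refl; sym; trans; cong; subst; subst₂)
open import Relation.Nullary using (Dec; yes; no; does; contradiction)
open import Relation.Nullary.Decidable using (_×-dec_; ¬?; dec-true)
open import Defs

-- Membership and cardinality of finite subsets.

∈-tabulate⁺ : ∀ {n} {P : Fin n → Set} (P? : ∀ v → Dec (P v)) {v} →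
              P v → v ∈ tabulate (does ∘ P?)
∈-tabulate⁺ P? {v} pv =
  lookup⇒[]= v _ (trans (lookup∘tabulate (does ∘ P?) v) (dec-true (P? v) pv))

∈-tabulate⁻ : ∀ {n} {P : Fin n → Set} (P? : ∀ v → Dec (P v)) {v} →
              v ∈ tabulate (does ∘ P?) → P v
∈-tabulate⁻ P? {v} v∈ with P? v | trans (sym (lookup∘tabulate (does ∘ P?) v)) ([]=⇒lookup v∈)
... | yes pv | _ = pv
... | no _   | ()

∉⇒outside : ∀ {n} {p : Subset n} {v} → v ∉ p → lookup p v ≡ outside
∉⇒outside {p = p} {v} v∉ with lookup p v in eq
... | inside  = contradiction (lookup⇒[]= v p eq) v∉
... | outside = refl

-- Induction on `p`: the image of an element at the head is deleted from `q`, at the cost of one,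
-- and injectivity keeps the remaining images away from it.
∣∣-injection : ∀ {m n} (p : Subset m) (q : Subset n) (f : Fin m → Fin n) →
               (∀ {i} → i ∈ p → f i ∈ q) →
               (∀ {i j} → i ∈ p → j ∈ p → f i ≡ f j → i ≡ j) →
               ∣ p ∣ ≤ ∣ q ∣
∣∣-injection []            q f f∈ inj = z≤n
∣∣-injection (outside ∷ p) q f f∈ inj = ∣∣-injection p q (f ∘ suc) (f∈ ∘ there)
  λ i∈ j∈ eq → suc-injective (inj (there i∈) (there j∈) eq)
∣∣-injection (inside ∷ p)  q f f∈ inj = ℕ.≤-trans
  (s≤s (∣∣-injection p (q - f zero) (f ∘ suc)
    (λ i∈ → x∈p∧x≢y⇒x∈p-y (f∈ (there i∈)) λ eq → contradiction (inj (there i∈) here eq) λ ())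
    λ i∈ j∈ eq → suc-injective (inj (there i∈) (there j∈) eq)))
  (x∈p⇒∣p-x∣<∣p∣ (f∈ here))

∣p∪⁅x⁆∣≤1+∣p∣ : ∀ {n} (p : Subset n) x → ∣ p ∪ ⁅ x ⁆ ∣ ≤ suc ∣ p ∣
∣p∪⁅x⁆∣≤1+∣p∣ (inside ∷ p)  zero    rewrite ∪-identityʳ p = ℕ.n≤1+n _
∣p∪⁅x⁆∣≤1+∣p∣ (outside ∷ p) zero    rewrite ∪-identityʳ p = ℕ.≤-refl
∣p∪⁅x⁆∣≤1+∣p∣ (inside ∷ p)  (suc x) = s≤s (∣p∪⁅x⁆∣≤1+∣p∣ p x)
∣p∪⁅x⁆∣≤1+∣p∣ (outside ∷ p) (suc x) = ∣p∪⁅x⁆∣≤1+∣p∣ p x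

∣++∣ : ∀ {m n} (p : Subset m) (q : Subset n) → ∣ p ++ q ∣ ≡ ∣ p ∣ + ∣ q ∣
∣++∣ []            q = refl
∣++∣ (inside ∷ p)  q = cong suc (∣++∣ p q)
∣++∣ (outside ∷ p) q = ∣++∣ p q

∣insertAt∣ : ∀ {n} (p : Subset n) x b → ∣ insertAt p x b ∣ ≡ ∣ b ∷ p ∣
∣insertAt∣ p             zero    b       = refl
∣insertAt∣ (inside ∷ p)  (suc x) inside  = cong suc (∣insertAt∣ p x inside)
∣insertAt∣ (inside ∷ p)  (suc x) outside = cong suc (∣insertAt∣ p x outside)
∣insertAt∣ (outside ∷ p) (suc x) inside  = ∣insertAt∣ p x inside
∣insertAt∣ (outside ∷ p) (suc x) outside = ∣insertAt∣ p x outside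

-- Private witnesses in a single graph.

module _ {n : ℕ} (G : Graph n) where
  open Graph G

  -- The condition `N w ∩ ∁ S ≡ ⁅ u ⁆` taken apart into elementwise facts, which can be transported
  -- between graphs without set equations.
  record Private (S : Subset n) (w u : Fin n) : Set where
    field
      w∈     : w ∈ S
      adj    : Adj w u
      u∉     : u ∉ S
      unique : ∀ {v} → Adj w v → v ∉ S → v ≡ u

  Witnessed : Subset n → Set
  Witnessed S = ∀ u → u ∉ S → ∃ λ w → Private S w u

  superDominating⇒witnessed : ∀ {S} → SuperDominating G S → Witnessed S
  superDominating⇒witnessed {S} (_ , sp) u u∉ with sp u (x∉p⇒x∈∁p u∉)
  ... | w , w∈S , eq = w , record
    { w∈     = w∈S
    ; adj    = ∈-tabulate⁻ (adj? w) (proj₁ (x∈p∩q⁻ _ _ (subst (u ∈_) (sym eq) (x∈⁅x⁆ u))))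
    ; u∉     = u∉
    ; unique = λ e v∉ → x∈⁅y⁆⇒x≡y u (subst (_ ∈_) eq
                          (x∈p∩q⁺ (∈-tabulate⁺ (adj? w) e , x∉p⇒x∈∁p v∉)))
    }

  -- The private witness of `u` lies in `S` and is adjacent to `u`, so it also serves as the
  -- dominating neighbour.
  witnessed⇒superDominating : ∀ {S} → Witnessed S → SuperDominating G S
  witnessed⇒superDominating {S} wit = dom , sp
    where
    dom : Dominating G S
    dom u u∈ with wit u (x∈∁p⇒x∉p u∈)
    ... | w , pr = w , Private.w∈ pr , adj-sym (Private.adj pr)

    sp : ∀ u → u ∈ ∁ S → ∃ λ w → w ∈ S × N w ∩ ∁ S ≡ ⁅ u ⁆
    sp u u∈ with wit u (x∈∁p⇒x∉p u∈)
    ... | w , pr = w , w∈ , ⊆-antisym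
        (λ v∈ → let v∈N , v∈∁ = x∈p∩q⁻ _ _ v∈ in
          Equivalence.from x∈⁅y⁆⇔x≡y (unique (∈-tabulate⁻ (adj? w) v∈N) (x∈∁p⇒x∉p v∈∁)))
        (λ v∈ → subst (_∈ N w ∩ ∁ S) (sym (x∈⁅y⁆⇒x≡y u v∈))
          (x∈p∩q⁺ (∈-tabulate⁺ (adj? w) adj , u∈)))
      where open Private pr

  -- `Witnessed` yields a witness that may depend on the proof of `u ∉ S`. Deciding membership first
  -- makes it depend on `u` alone, so that its image can be formed; on `S` the value is a dummy.
  witnessFunction : ∀ {S} → Witnessed S →
                    ∃ λ (f : Fin n → Fin n) → ∀ {u} → u ∉ S → Private S (f u) u
  witnessFunction {S} wit = proj₁ ∘ choose , λ {u} → proj₂ (choose u)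
    where
    choose : ∀ u → ∃ λ w → u ∉ S → Private S w u
    choose u with u ∈? S
    ... | yes u∈ = u , contradiction u∈
    ... | no u∉  = let w , pr = wit u u∉ in w , λ _ → pr

  -- The new set is the complement of the set `W` of chosen witnesses. It contains `x` because
  -- witnesses lie in `S`.
  exchange : ∀ {S} → Witnessed S → ∀ {x} → x ∉ S →
             ∃ λ S′ → Witnessed S′ × x ∈ S′ × ∣ S′ ∣ ≤ ∣ S ∣
  exchange {S} wit {x} x∉ =
    ∁ W , wit′ , x∉p⇒x∈∁p (λ x∈ → x∉ (W⊆S x∈)) , size
    where
    f : Fin n → Fin n
    f = proj₁ (witnessFunction wit)

    private-f : ∀ {u} → u ∉ S → Private S (f u) u
    private-f = proj₂ (witnessFunction wit)

    inImage? : ∀ c → Dec (∃ λ u → u ∉ S × f u ≡ c)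
    inImage? c = any? λ u → ¬? (u ∈? S) ×-dec (f u ≟ c)

    W : Subset n
    W = tabulate (does ∘ inImage?)

    W⊆S : ∀ {c} → c ∈ W → c ∈ S
    W⊆S c∈ with ∈-tabulate⁻ inImage? c∈
    ... | u , u∉ , refl = Private.w∈ (private-f u∉)

    wit′ : Witnessed (∁ W)
    wit′ c c∉ with ∈-tabulate⁻ inImage? (x∉∁p⇒x∈p c∉)
    ... | u , u∉ , refl = u , record
      -- The roles are reversed: `u` now witnesses `f u`.
      { w∈     = x∉p⇒x∈∁p (λ u∈ → u∉ (W⊆S u∈))
      ; adj    = adj-sym (Private.adj (private-f u∉))
      ; u∉     = c∉
      ; unique = unique′
      }
      where
      unique′ : ∀ {v} → Adj u v → v ∉ ∁ W → v ≡ f u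
      unique′ e v∉ with ∈-tabulate⁻ inImage? (x∉∁p⇒x∈p v∉)
      -- If `u` is adjacent to another witness `f u′`, then `u` is a neighbour of `f u′` outside
      -- `S`, hence `u` is `u′`.
      ... | u′ , u′∉ , refl =
        cong f (sym (Private.unique (private-f u′∉) (adj-sym e) u∉))

    -- `f` is injective off `S`, since a witness has only one neighbour there.
    ∣∁S∣≤∣W∣ : ∣ ∁ S ∣ ≤ ∣ W ∣
    ∣∁S∣≤∣W∣ = ∣∣-injection (∁ S) W f
      (λ u∈ → ∈-tabulate⁺ inImage? (_ , x∈∁p⇒x∉p u∈ , refl))
      (λ {i} {j} i∈ j∈ eq →
        let i∉ = x∈∁p⇒x∉p i∈ ; j∉ = x∈∁p⇒x∉p j∈ in
        Private.unique (private-f j∉) (subst (λ w → Adj w i) eq (Private.adj (private-f i∉))) i∉)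

    size : ∣ ∁ W ∣ ≤ ∣ S ∣
    size = subst₂ _≤_ (sym (∣∁p∣≡n∸∣p∣ W))
      (trans (cong (n ∸_) (∣∁p∣≡n∸∣p∣ S)) (ℕ.m∸[m∸n]≡n (∣p∣≤n S)))
      (ℕ.∸-monoʳ-≤ n ∣∁S∣≤∣W∣)

  minimal : ∀ {k} → IsSuperDominationNumber G k → ∀ {S} → Witnessed S → k ≤ ∣ S ∣
  minimal (_ , k-min) wit = k-min _ (witnessed⇒superDominating wit)

  attained-containing : ∀ {k} → IsSuperDominationNumber G k →
                        ∀ x → ∃ λ S → Witnessed S × x ∈ S × ∣ S ∣ ≤ k
  attained-containing ((S , sd , refl) , _) x with x ∈? S
  ... | yes x∈ = S , superDominating⇒witnessed sd , x∈ , ℕ.≤-refl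
  ... | no x∉  = exchange (superDominating⇒witnessed sd) x∉

  -- When `x` is never called on as a witness, the new neighbours that `x` gains in a bouquet cannot
  -- spoil any witness.
  WitnessedAvoiding : Fin n → Subset n → Set
  WitnessedAvoiding x S = ∀ u → u ∉ S → ∃ λ w → Private S w u × w ≢ x

  -- In repaired, x is a witness in S, and S⁺ adds to S the vertex that x witnesses.
  data Optimal (k : ℕ) (x : Fin n) : Set where
    avoiding : ∀ S → x ∈ S → WitnessedAvoiding x S → ∣ S ∣ ≤ k → Optimal k x
    repaired : ∀ S → x ∈ S → Witnessed S → ∣ S ∣ ≤ k →
               ∀ S⁺ → x ∈ S⁺ → WitnessedAvoiding x S⁺ → (∀ {v} → Adj x v → v ∈ S⁺) →
               ∣ S⁺ ∣ ≤ suc (k) → Optimal k x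

  optimal⇒avoiding : ∀ {k x} → Optimal k x →
    ∃ λ S → x ∈ S × WitnessedAvoiding x S × ∣ S ∣ ≤ suc (k)
  optimal⇒avoiding (avoiding S x∈ wit le)               = S , x∈ , wit , ℕ.m≤n⇒m≤1+n le
  optimal⇒avoiding (repaired _ _ _ _ S⁺ x∈ wit⁺ _ le⁺) = S⁺ , x∈ , wit⁺ , le⁺

  optimal : ∀ {k} → IsSuperDominationNumber G k → ∀ x → Optimal k x
  optimal isγ x with attained-containing isγ x
  ... | S , wit , x∈ , le with witnessFunction wit
  ... | f , private-f with any? (λ u → ¬? (u ∈? S) ×-dec (f u ≟ x))
  ...   | no none = avoiding S x∈ (λ u u∉ → f u , private-f u∉ , λ eq → none (u , u∉ , eq)) le
  ...   | yes (u₀ , u₀∉ , refl) =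
    repaired S x∈ wit le S⁺ (p⊆p∪q _ x∈) wit⁺ closed
      (ℕ.≤-trans (∣p∪⁅x⁆∣≤1+∣p∣ S u₀) (s≤s le))
    where
    S⁺ : Subset n
    S⁺ = S ∪ ⁅ u₀ ⁆

    -- The old witnesses still work for the larger set. A vertex still witnessed by `f u₀` would
    -- have to be `u₀`, which has just been added.
    wit⁺ : WitnessedAvoiding (f u₀) S⁺
    wit⁺ u u∉⁺ = f u , record
        { w∈ = p⊆p∪q _ w∈ ; adj = adj ; u∉ = u∉⁺
        ; unique = λ e v∉ → unique e (v∉ ∘ p⊆p∪q _) }
      , λ eq → u∉⁺ (q⊆p∪q S _ (Equivalence.from x∈⁅y⁆⇔x≡y
          (Private.unique (private-f u₀∉) (subst (λ w → Adj w u) eq adj) (u∉⁺ ∘ p⊆p∪q _))))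
      where open Private (private-f (u∉⁺ ∘ p⊆p∪q ⁅ u₀ ⁆))

    -- The only neighbour of `f u₀` that `S` misses is `u₀`.
    closed : ∀ {v} → Adj (f u₀) v → v ∈ S⁺
    closed {v} e with v ∈? S
    ... | yes v∈ = p⊆p∪q _ v∈
    ... | no v∉  = q⊆p∪q S _ (Equivalence.from x∈⁅y⁆⇔x≡y (Private.unique (private-f u₀∉) e v∉))

-- Bouquets of a family of graphs: restricting and gluing witnessed sets.

record IsBouquet {I : Set} {n : I → ℕ} (G : ∀ i → Graph (n i)) (x : ∀ i → Fin (n i))
                 {N : ℕ} (H : Graph N) : Set where
  field
    root             : Fin N
    embed            : ∀ i → Fin (n i) → Fin N
    embed-root       : ∀ i → embed i (x i) ≡ root
    embed-injective  : ∀ {i p q} → embed i p ≡ embed i q → p ≡ q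
    embed-meet       : ∀ {i j p q} → i ≢ j → embed i p ≡ embed j q → p ≡ x i × q ≡ x j
    embed-surjective : ∀ c → ∃₂ λ i p → embed i p ≡ c
    adj⁺             : ∀ {i p q} → Graph.Adj (G i) p q → Graph.Adj H (embed i p) (embed i q)
    adj⁻             : ∀ {c d} → Graph.Adj H c d →
                       ∃ λ i → ∃₂ λ p q → embed i p ≡ c × embed i q ≡ d × Graph.Adj (G i) p q

module _ {I : Set} (_≟ᴵ_ : DecidableEquality I) {n : I → ℕ} {G : ∀ i → Graph (n i)}
         {x : ∀ i → Fin (n i)} {N : ℕ} {H : Graph N} (B : IsBouquet G x H) where
  open IsBouquet B

  -- `A` is the trace of `S` on copy `i`, possibly with the root added. A vertex other than the root
  -- has all its neighbours in its own copy, so its witness restricts with it. The witness of the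
  -- root may lie in another copy, which is why it is demanded separately.
  restrict-witnessed :
    ∀ {S i A} → Witnessed H S →
    (∀ {p} → embed i p ∈ S → p ∈ A) →
    (∀ {p} → p ∈ A → embed i p ∉ S → p ≡ x i) →
    (x i ∉ A → ∃ λ w → Private H S (embed i w) root) →
    Witnessed (G i) A
  restrict-witnessed {S} {i} {A} wit S⇒A A⇒S root-wit u u∉A = go (u ≟ x i)
    where
    -- Vertices outside `A` embed outside `S`, so uniqueness is inherited even if the root was added
    -- to `A`.
    pull : ∀ {w} → Private H S (embed i w) (embed i u) → Graph.Adj (G i) w u →
           Private (G i) A w u
    pull pr e = record
      { w∈ = S⇒A w∈ ; adj = e ; u∉ = u∉A
      ; unique = λ e′ v∉ → embed-injective (unique (adj⁺ e′) (v∉ ∘ S⇒A)) }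
      where open Private pr

    adj-reflect : ∀ {w} → Graph.Adj H (embed i w) (embed i u) → Graph.Adj (G i) w u
    adj-reflect {w} e with adj⁻ e
    ... | j , p , q , eqp , eqq , e′ with i ≟ᴵ j
    ...   | yes refl = subst₂ (Graph.Adj (G i)) (embed-injective eqp) (embed-injective eqq) e′
    ...   | no i≢j with embed-meet i≢j (sym eqp) | embed-meet i≢j (sym eqq)
    -- An edge coming from another copy would have both ends at the root of that copy and be a loop.
    ...     | _ , refl | _ , refl = contradiction e′ (Graph.adj-irrefl (G j) refl)

    go : Dec (u ≡ x i) → ∃ λ w → Private (G i) A w u
    go (yes refl) with root-wit u∉A
    ... | w , pr = w , pull pr′ (adj-reflect (Private.adj pr′))
      where
      pr′ : Private H S (embed i w) (embed i u)
      pr′ = subst (Private H S (embed i w)) (sym (embed-root i)) pr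
    go (no u≢x) with wit (embed i u) (u∉A ∘ S⇒A)
    ... | c , pr with adj⁻ (Private.adj pr)
    ...   | j , p , q , eqp , eqq , e with i ≟ᴵ j
    ...     | no i≢j   = contradiction (proj₁ (embed-meet i≢j (sym eqq))) u≢x
    ...     | yes refl with refl ← eqp | refl ← embed-injective eqq = p , pull pr e

  -- A witness gains neighbours in the other copies only if it is the root. The last hypothesis then
  -- requires all neighbours of the root in those copies to belong to the set, so the witness stays
  -- private.
  glue-witnessed :
    ∀ {S} (A : ∀ i → Subset (n i)) →
    (∀ i {p} → embed i p ∈ S → p ∈ A i) →
    (∀ i {p} → p ∈ A i → embed i p ∈ S) →
    (∀ i u → u ∉ A i → ∃ λ w → Private (G i) (A i) w u ×
      (w ≢ x i ⊎ (∀ j → i ≢ j → ∀ {v} → Graph.Adj (G j) (x j) v → v ∈ A j))) →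
    Witnessed H S
  glue-witnessed {S} A S⇒A A⇒S wit c c∉ with embed-surjective c
  ... | i , u , refl with wit i u (c∉ ∘ A⇒S i)
  ...   | w , pr , side = embed i w , record
    { w∈ = A⇒S i w∈ ; adj = adj⁺ adj ; u∉ = c∉ ; unique = unique′ }
    where
    open Private pr
    unique′ : ∀ {d} → Graph.Adj H (embed i w) d → d ∉ S → d ≡ embed i u
    unique′ e d∉ with adj⁻ e
    ... | j , p , q , eqp , refl , e′ with i ≟ᴵ j
    ...   | yes refl with refl ← embed-injective eqp =
      cong (embed i) (unique e′ (d∉ ∘ A⇒S i))
    ...   | no i≢j with embed-meet i≢j (sym eqp)
    ...     | w≡x , refl = [ contradiction w≡x
                           , (λ closed → contradiction (A⇒S j (closed j i≢j e′)) d∉) ]′ side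

-- The indices tell which summands carry a `suc`. The surplus 2 has two sources: three sets sharing
-- the merged vertex count it twice too often, or two of three sets are enlarged by one vertex.
sum-suc₀₁₂ : ∀ a b c → suc a + suc b + suc c ≡ 2 + (1 + (a + (b + c)))
sum-suc₀₁₂ = solve 3 (λ a b c →
  (con 1 :+ a) :+ (con 1 :+ b) :+ (con 1 :+ c) := con 2 :+ (con 1 :+ (a :+ (b :+ c)))) refl
  where open +-*-Solver

sum-suc₁₂ : ∀ a b c → a + suc b + suc c ≡ 2 + (a + (b + c))
sum-suc₁₂ = solve 3 (λ a b c →
  a :+ (con 1 :+ b) :+ (con 1 :+ c) := con 2 :+ (a :+ (b :+ c))) refl
  where open +-*-Solver

sum-suc₀₂ : ∀ a b c → suc a + b + suc c ≡ 2 + (a + (b + c))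
sum-suc₀₂ = solve 3 (λ a b c →
  (con 1 :+ a) :+ b :+ (con 1 :+ c) := con 2 :+ (a :+ (b :+ c))) refl
  where open +-*-Solver

sum-suc₀₁ : ∀ a b c → suc a + suc b + c ≡ 2 + (a + (b + c))
sum-suc₀₁ = solve 3 (λ a b c →
  (con 1 :+ a) :+ (con 1 :+ b) :+ c := con 2 :+ (a :+ (b :+ c))) refl
  where open +-*-Solver

triple : ∀ {a} {A : Fin 3 → Set a} → A 0F → A 1F → A 2F → ∀ i → A i
triple a b c 0F = a
triple a b c 1F = b
triple a b c 2F = c

-- The bouquet of three graphs and its subsets.

module _
  {n₁ n₂ n₃ : ℕ}
  (G₁ : Graph (suc n₁)) (x₁ : Fin (suc n₁))
  (G₂ : Graph (suc n₂)) (x₂ : Fin (suc n₂))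
  (G₃ : Graph (suc n₃)) (x₃ : Fin (suc n₃))
  where

  private
    open Bouquet G₁ x₁ G₂ x₂ G₃ x₃ hiding (bouquet)

    H : Graph (suc (n₁ + (n₂ + n₃)))
    H = bouquet G₁ x₁ G₂ x₂ G₃ x₃

    n : Fin 3 → ℕ
    n = triple n₁ n₂ n₃

    order : Fin 3 → ℕ
    order = suc ∘ n

    G : ∀ i → Graph (order i)
    G = triple G₁ G₂ G₃

    x : ∀ i → Fin (order i)
    x = triple x₁ x₂ x₃

    inject : ∀ i → Fin (order i) → V⊎
    inject = triple inj₁ (inj₂ ∘ inj₁) (inj₂ ∘ inj₂)

    inject-injective : ∀ i {p q} → inject i p ≡ inject i q → p ≡ q
    inject-injective 0F refl = refl
    inject-injective 1F refl = refl
    inject-injective 2F refl = refl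

    inject-disjoint : ∀ i j {p q} → inject i p ≡ inject j q → i ≡ j
    inject-disjoint 0F 0F eq = refl
    inject-disjoint 1F 1F eq = refl
    inject-disjoint 2F 2F eq = refl
    inject-disjoint 0F 1F ()
    inject-disjoint 0F 2F ()
    inject-disjoint 1F 0F ()
    inject-disjoint 1F 2F ()
    inject-disjoint 2F 0F ()
    inject-disjoint 2F 1F ()

    root⁺ : ∀ i → Root (inject i (x i))
    root⁺ 0F = root₁
    root⁺ 1F = root₂
    root⁺ 2F = root₃

    root⁻ : ∀ i {p} → Root (inject i p) → p ≡ x i
    root⁻ 0F root₁ = refl
    root⁻ 1F root₂ = refl
    root⁻ 2F root₃ = refl

    injective : ∀ {i p q} → identify (inject i p) ≡ identify (inject i q) → p ≡ q
    injective {i} {p} {q} eq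
      with Equivalence.to (identify-kernel (inject i p) (inject i q)) eq
    ... | inj₁ eq′       = inject-injective i eq′
    ... | inj₂ (rp , rq) = trans (root⁻ i rp) (sym (root⁻ i rq))

    meet : ∀ {i j p q} → i ≢ j → identify (inject i p) ≡ identify (inject j q) →
           p ≡ x i × q ≡ x j
    meet {i} {j} {p} {q} i≢j eq
      with Equivalence.to (identify-kernel (inject i p) (inject j q)) eq
    ... | inj₁ eq′       = contradiction (inject-disjoint i j eq′) i≢j
    ... | inj₂ (rp , rq) = root⁻ i rp , root⁻ j rq

    surjective : ∀ c → ∃₂ λ i p → identify (inject i p) ≡ c
    surjective c with identify-surjective c
    ... | inj₁ v        , eq = 0F , v , eq
    ... | inj₂ (inj₁ v) , eq = 1F , v , eq
    ... | inj₂ (inj₂ v) , eq = 2F , v , eq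

    adj⊎⁺ : ∀ i {p q} → Graph.Adj (G i) p q → Adj⊎ (inject i p) (inject i q)
    adj⊎⁺ 0F e = Pointwise.inj₁ e
    adj⊎⁺ 1F e = Pointwise.inj₂ (Pointwise.inj₁ e)
    adj⊎⁺ 2F e = Pointwise.inj₂ (Pointwise.inj₂ e)

    adj⊎⁻ : ∀ {c d} → BouquetAdj c d →
            ∃ λ i → ∃₂ λ p q →
              identify (inject i p) ≡ c × identify (inject i q) ≡ d × Graph.Adj (G i) p q
    adj⊎⁻ (_ , _ , eq , eq′ , Pointwise.inj₁ e)        = 0F , _ , _ , eq , eq′ , e
    adj⊎⁻ (_ , _ , eq , eq′ , Pointwise.inj₂ (Pointwise.inj₁ e)) = 1F , _ , _ , eq , eq′ , e
    adj⊎⁻ (_ , _ , eq , eq′ , Pointwise.inj₂ (Pointwise.inj₂ e)) = 2F , _ , _ , eq , eq′ , e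

    isBouquet : IsBouquet G x H
    isBouquet = record
      { root             = zero
      ; embed            = λ i → identify ∘ inject i
      ; embed-root       = identify-root ∘ root⁺
      ; embed-injective  = λ {i} → injective {i}
      ; embed-meet       = meet
      ; embed-surjective = surjective
      ; adj⁺             = λ {i} e → _ , _ , refl , refl , adj⊎⁺ i e
      ; adj⁻             = adj⊎⁻
      }

    open IsBouquet isBouquet using (embed; embed-root)

    -- This follows the numbering of the bouquet: first the bit of the merged vertex, then the
    -- remaining vertices of the three graphs in order. The family `s` thus leaves the roots out.
    assemble : Bool → (∀ i → Subset (n i)) → Subset (suc (n₁ + (n₂ + n₃)))
    assemble b s = b ∷ s 0F ++ (s 1F ++ s 2F)

    lookup-number : ∀ b s i k →
                    ∃ λ c → embed i (punchIn (x i) k) ≡ c × lookup (assemble b s) c ≡ lookup (s i) k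
    lookup-number b s 0F k =
      _ , identify-other (inj₁ k) , lookup-++ˡ (s 0F) _ k
    lookup-number b s 1F k =
      _ , identify-other (inj₂ (inj₁ k)) ,
      trans (lookup-++ʳ (s 0F) _ _) (lookup-++ˡ (s 1F) _ k)
    lookup-number b s 2F k =
      _ , identify-other (inj₂ (inj₂ k)) ,
      trans (lookup-++ʳ (s 0F) _ _) (lookup-++ʳ (s 1F) _ k)

    -- Away from the root the inserted bit is invisible. It is kept independent of `b` because a
    -- restriction may contain the root when the bouquet set does not.
    lookup-assemble-punchIn : ∀ b s i k b′ →
      lookup (assemble b s) (embed i (punchIn (x i) k)) ≡
      lookup (insertAt (s i) (x i) b′) (punchIn (x i) k)
    lookup-assemble-punchIn b s i k b′ =
      let c , eq , eq′ = lookup-number b s i k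
      in  trans (cong (lookup (assemble b s)) eq)
            (trans eq′ (sym (insertAt-punchIn (s i) (x i) b′ k)))

    lookup-assemble-≢ : ∀ b s i p b′ → x i ≢ p →
      lookup (assemble b s) (embed i p) ≡ lookup (insertAt (s i) (x i) b′) p
    lookup-assemble-≢ b s i p b′ x≢p = subst
      (λ p → lookup (assemble b s) (embed i p) ≡ lookup (insertAt (s i) (x i) b′) p)
      (punchIn-punchOut x≢p) (lookup-assemble-punchIn b s i (punchOut x≢p) b′)

    lookup-assemble : ∀ b s i p →
      lookup (assemble b s) (embed i p) ≡ lookup (insertAt (s i) (x i) b) p
    lookup-assemble b s i p with x i ≟ p
    ... | yes refl = trans (cong (lookup (assemble b s)) (embed-root i))
                       (sym (insertAt-lookup (s i) (x i) b))
    ... | no x≢p   = lookup-assemble-≢ b s i p b x≢p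

    ∣assemble∣ : ∀ b s → ∣ assemble b s ∣ ≡ ∣ b ∷ [] ∣ + (∣ s 0F ∣ + (∣ s 1F ∣ + ∣ s 2F ∣))
    ∣assemble∣ b s = trans (∣++∣ (b ∷ []) (s 0F ++ (s 1F ++ s 2F)))
      (cong (∣ b ∷ [] ∣ +_) (trans (∣++∣ (s 0F) _) (cong (∣ s 0F ∣ +_) (∣++∣ (s 1F) (s 2F)))))

    -- The bit `b′` decides whether the restriction contains the root. It may be added, never
    -- removed; if it stays outside, copy `i` must hold a witness of the merged vertex.
    restrict-assembled : ∀ {b s} i b′ → Witnessed H (assemble b s) →
      (b ≡ inside → b′ ≡ inside) →
      (b′ ≡ outside → ∃ λ w → Private H (assemble b s) (embed i w) zero) →
      ∃ λ A → Witnessed (G i) A × ∣ A ∣ ≡ ∣ b′ ∷ s i ∣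
    restrict-assembled {b} {s} i b′ wit b⇒b′ root-wit =
        insertAt (s i) (x i) b′
      , restrict-witnessed _≟_ isBouquet {i = i} wit S⇒A A⇒S
          (λ x∉ → root-wit (trans (sym (insertAt-lookup (s i) (x i) b′)) (∉⇒outside x∉)))
      , ∣insertAt∣ (s i) (x i) b′
      where
      S⇒A : ∀ {p} → embed i p ∈ assemble b s → p ∈ insertAt (s i) (x i) b′
      S⇒A {p} p∈ with x i ≟ p
      ... | no x≢p   = lookup⇒[]= p _ (trans (sym (lookup-assemble-≢ b s i p b′ x≢p)) ([]=⇒lookup p∈))
      ... | yes refl = lookup⇒[]= p _ (trans (insertAt-lookup (s i) (x i) b′) (b⇒b′
        (trans (sym (insertAt-lookup (s i) (x i) b))
          (trans (sym (lookup-assemble b s i p)) ([]=⇒lookup p∈)))))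

      A⇒S : ∀ {p} → p ∈ insertAt (s i) (x i) b′ → embed i p ∉ assemble b s → p ≡ x i
      A⇒S {p} p∈ p∉ with x i ≟ p
      ... | yes refl = refl
      ... | no x≢p   = contradiction
        (lookup⇒[]= (embed i p) _ (trans (lookup-assemble-≢ b s i p b′ x≢p) ([]=⇒lookup p∈))) p∉

    -- All three sets contain their roots, so the merged vertex is counted three times on the right
    -- and once in `S`.
    glue : (A : ∀ i → Subset (order i)) → (∀ i → x i ∈ A i) →
      (∀ i u → u ∉ A i → ∃ λ w → Private (G i) (A i) w u ×
        (w ≢ x i ⊎ (∀ j → i ≢ j → ∀ {v} → Graph.Adj (G j) (x j) v → v ∈ A j))) →
      ∃ λ S → Witnessed H S × 2 + ∣ S ∣ ≡ ∣ A 0F ∣ + ∣ A 1F ∣ + ∣ A 2F ∣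
    glue A x∈ wit =
      assemble inside s , glue-witnessed _≟_ isBouquet A S⇒A A⇒S wit , size
      where
      s : ∀ i → Subset (n i)
      s i = removeAt (A i) (x i)

      insert-s : ∀ i → insertAt (s i) (x i) inside ≡ A i
      insert-s i = trans (cong (insertAt (s i) (x i)) (sym ([]=⇒lookup (x∈ i))))
                     (insertAt-removeAt (A i) (x i))

      lookup-S : ∀ i p → lookup (assemble inside s) (embed i p) ≡ lookup (A i) p
      lookup-S i p = trans (lookup-assemble inside s i p) (cong (λ a → lookup a p) (insert-s i))

      S⇒A : ∀ i {p} → embed i p ∈ assemble inside s → p ∈ A i
      S⇒A i {p} p∈ = lookup⇒[]= p _ (trans (sym (lookup-S i p)) ([]=⇒lookup p∈))

      A⇒S : ∀ i {p} → p ∈ A i → embed i p ∈ assemble inside s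
      A⇒S i {p} p∈ = lookup⇒[]= (embed i p) _ (trans (lookup-S i p) ([]=⇒lookup p∈))

      ∣A∣ : ∀ i → ∣ A i ∣ ≡ suc ∣ s i ∣
      ∣A∣ i = trans (cong ∣_∣ (sym (insert-s i))) (∣insertAt∣ (s i) (x i) inside)

      size : 2 + ∣ assemble inside s ∣ ≡ ∣ A 0F ∣ + ∣ A 1F ∣ + ∣ A 2F ∣
      size rewrite ∣A∣ 0F | ∣A∣ 1F | ∣A∣ 2F | ∣assemble∣ inside s =
        sym (sum-suc₀₁₂ (∣ s 0F ∣) (∣ s 1F ∣) (∣ s 2F ∣))

    lower-arith : ∀ {a b c a′ b′ c′ k} → a ≤ a′ → b ≤ b′ → c ≤ c′ →
                  a′ + b′ + c′ ≡ 2 + k → (a + b + c) ∸ 2 ≤ k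
    lower-arith p q r eq =
      ℕ.∸-monoˡ-≤ 2 (ℕ.≤-trans (ℕ.+-mono-≤ (ℕ.+-mono-≤ p q) r) (ℕ.≤-reflexive eq))

  -- The lower bound.

  witnessed-bound : ∀ {k₁ k₂ k₃} →
    (∀ {A} → Witnessed G₁ A → k₁ ≤ ∣ A ∣) →
    (∀ {A} → Witnessed G₂ A → k₂ ≤ ∣ A ∣) →
    (∀ {A} → Witnessed G₃ A → k₃ ≤ ∣ A ∣) →
    ∀ {S} → Witnessed H S → (k₁ + k₂ + k₃) ∸ 2 ≤ ∣ S ∣
  -- Splitting the vector twice brings an arbitrary subset into the form `assemble b s`.
  witnessed-bound {k₁} {k₂} {k₃} min₁ min₂ min₃ {b ∷ v} wit with splitAt n₁ v
  ... | s₁ , v′ , refl with splitAt n₂ v′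
  ...   | s₂ , s₃ , refl = go b wit
    where
    s : ∀ i → Subset (n i)
    s = triple s₁ s₂ s₃

    k : Fin 3 → ℕ
    k = triple k₁ k₂ k₃

    min : ∀ i {A} → Witnessed (G i) A → k i ≤ ∣ A ∣
    min 0F = min₁
    min 1F = min₂
    min 2F = min₃

    bound : ∀ {b} i b′ → Witnessed H (assemble b s) →
      (b ≡ inside → b′ ≡ inside) →
      (b′ ≡ outside → ∃ λ w → Private H (assemble b s) (embed i w) zero) →
      k i ≤ ∣ b′ ∷ s i ∣
    bound {b} i b′ wit b⇒b′ root-wit =
      let A , witA , eq = restrict-assembled {b} {s} i b′ wit b⇒b′ root-wit
      in  subst (k i ≤_) eq (min i witA)

    Goal : Bool → Set
    Goal b = (k₁ + k₂ + k₃) ∸ 2 ≤ ∣ assemble b s ∣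

    go : ∀ b → Witnessed H (assemble b s) → Goal b
    go inside wit = lower-arith (full 0F) (full 1F) (full 2F)
      (trans (sum-suc₀₁₂ (∣ s₁ ∣) (∣ s₂ ∣) (∣ s₃ ∣)) (cong (2 +_) (sym (∣assemble∣ inside s))))
      where
      full : ∀ i → k i ≤ suc ∣ s i ∣
      full i = bound {inside} i inside wit (λ _ → refl) λ ()
    -- The edge from the merged vertex to its witness places that witness in some copy `i`. The
    -- restriction to copy `i` can leave the root out; the other two receive it, which costs 2 in
    -- total.
    go outside wit with wit zero (λ ())
    ... | c , pr with adj⊎⁻ (Private.adj pr)
    ...   | i , p , q , refl , _ , _ = finish i pr
      where
      full : ∀ j → k j ≤ suc ∣ s j ∣
      full j = bound {outside} j inside wit (λ ()) λ ()

      bare : ∀ j {p} → Private H (assemble outside s) (embed j p) zero → k j ≤ ∣ s j ∣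
      bare j pr = bound {outside} j outside wit (λ ()) λ _ → _ , pr

      size : ∀ {m} → m ≡ 2 + (∣ s₁ ∣ + (∣ s₂ ∣ + ∣ s₃ ∣)) → m ≡ 2 + ∣ assemble outside s ∣
      size eq = trans eq (cong (2 +_) (sym (∣assemble∣ outside s)))

      finish : ∀ i {p} → Private H (assemble outside s) (embed i p) zero → Goal outside
      finish 0F pr = lower-arith (bare 0F pr) (full 1F) (full 2F)
        (size (sum-suc₁₂ (∣ s₁ ∣) (∣ s₂ ∣) (∣ s₃ ∣)))
      finish 1F pr = lower-arith (full 0F) (bare 1F pr) (full 2F)
        (size (sum-suc₀₂ (∣ s₁ ∣) (∣ s₂ ∣) (∣ s₃ ∣)))
      finish 2F pr = lower-arith (full 0F) (full 1F) (bare 2F pr)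
        (size (sum-suc₀₁ (∣ s₁ ∣) (∣ s₂ ∣) (∣ s₃ ∣)))

  -- The upper bound.

  witnessed-exists : ∀ {k₁ k₂ k₃} →
    Optimal G₁ k₁ x₁ → Optimal G₂ k₂ x₂ → Optimal G₃ k₃ x₃ →
    ∃ λ S → Witnessed H S × ∣ S ∣ ≤ k₁ + k₂ + k₃
  witnessed-exists {k₁} {k₂} {k₃} = go
    where
    Goal : Set
    Goal = ∃ λ S → Witnessed H S × ∣ S ∣ ≤ k₁ + k₂ + k₃

    -- Gluing saves two vertices, which pays for enlarging two of the three sets by one.
    conclude : ∀ {a b c a′ b′ c′} →
               (∃ λ S → Witnessed H S × 2 + ∣ S ∣ ≡ a + b + c) → a ≤ a′ → b ≤ b′ → c ≤ c′ →
               a′ + b′ + c′ ≡ 2 + (k₁ + (k₂ + k₃)) → Goal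
    conclude (S , wit , eq) p q r eq′ = S , wit , ℕ.+-cancelˡ-≤ 2 _ _ (ℕ.≤-trans
      (ℕ.≤-reflexive eq) (ℕ.≤-trans (ℕ.+-mono-≤ (ℕ.+-mono-≤ p q) r)
        (ℕ.≤-reflexive (trans eq′ (cong (2 +_) (sym (ℕ.+-assoc k₁ k₂ k₃)))))))

    glue-avoiding : (A : ∀ i → Subset (order i)) → (∀ i → x i ∈ A i) →
      (∀ i → WitnessedAvoiding (G i) (x i) (A i)) →
      ∃ λ S → Witnessed H S × 2 + ∣ S ∣ ≡ ∣ A 0F ∣ + ∣ A 1F ∣ + ∣ A 2F ∣
    glue-avoiding A x∈ wit = glue A x∈ λ i u u∉ →
      let w , pr , w≢x = wit i u u∉ in w , pr , inj₁ w≢x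

    go : Optimal G₁ k₁ x₁ → Optimal G₂ k₂ x₂ → Optimal G₃ k₃ x₃ → Goal
    -- A graph whose set avoids the root as a witness keeps its set; the other two may spend one
    -- extra vertex each.
    go (avoiding A x∈A witA leA) o₂ o₃ =
      let B , x∈B , witB , leB = optimal⇒avoiding G₂ o₂
          C , x∈C , witC , leC = optimal⇒avoiding G₃ o₃
      in  conclude (glue-avoiding (triple A B C) (triple x∈A x∈B x∈C) (triple witA witB witC))
            leA leB leC (sum-suc₁₂ (k₁) (k₂) (k₃))
    go o₁ (avoiding B x∈B witB leB) o₃ =
      let A , x∈A , witA , leA = optimal⇒avoiding G₁ o₁
          C , x∈C , witC , leC = optimal⇒avoiding G₃ o₃
      in  conclude (glue-avoiding (triple A B C) (triple x∈A x∈B x∈C) (triple witA witB witC))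
            leA leB leC (sum-suc₀₂ (k₁) (k₂) (k₃))
    go o₁ o₂ (avoiding C x∈C witC leC) =
      let A , x∈A , witA , leA = optimal⇒avoiding G₁ o₁
          B , x∈B , witB , leB = optimal⇒avoiding G₂ o₂
      in  conclude (glue-avoiding (triple A B C) (triple x∈A x∈B x∈C) (triple witA witB witC))
            leA leB leC (sum-suc₀₁ (k₁) (k₂) (k₃))
    -- All three roots are witnesses. The first set stays unrepaired and its root keeps witnessing;
    -- the repaired `B` and `C` contain all neighbours of their roots, so the merged vertex sees
    -- nothing outside the set there.
    go (repaired A x∈A witA leA _ _ _ _ _)
       (repaired _ _ _ _ B x∈B witB closedB leB)
       (repaired _ _ _ _ C x∈C witC closedC leC) =
      conclude (glue S (triple x∈A x∈B x∈C) wit)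
        leA leB leC (sum-suc₁₂ (k₁) (k₂) (k₃))
      where
      S : ∀ i → Subset (order i)
      S = triple A B C

      closed : ∀ j → 0F ≢ j → ∀ {v} → Graph.Adj (G j) (x j) v → v ∈ S j
      closed 0F 0≢0 e = contradiction refl 0≢0
      closed 1F _   e = closedB e
      closed 2F _   e = closedC e

      wit : ∀ i u → u ∉ S i → ∃ λ w → Private (G i) (S i) w u ×
        (w ≢ x i ⊎ (∀ j → i ≢ j → ∀ {v} → Graph.Adj (G j) (x j) v → v ∈ S j))
      wit 0F u u∉ = let w , pr = witA u u∉ in w , pr , inj₂ closed
      wit 1F u u∉ = let w , pr , w≢x = witB u u∉ in w , pr , inj₁ w≢x
      wit 2F u u∉ = let w , pr , w≢x = witC u u∉ in w , pr , inj₁ w≢x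

  lower-bound : ∀ {k₁ k₂ k₃ k} →
    IsSuperDominationNumber G₁ k₁ → IsSuperDominationNumber G₂ k₂ →
    IsSuperDominationNumber G₃ k₃ → IsSuperDominationNumber H k →
    (k₁ + k₂ + k₃) ∸ 2 ≤ k
  lower-bound γ₁ γ₂ γ₃ γ =
    let S , sd , eq = proj₁ γ in
    subst (_ ≤_) eq (witnessed-bound (minimal G₁ γ₁) (minimal G₂ γ₂) (minimal G₃ γ₃)
      (superDominating⇒witnessed H sd))

  upper-bound : ∀ {k₁ k₂ k₃ k} →
    IsSuperDominationNumber G₁ k₁ → IsSuperDominationNumber G₂ k₂ →
    IsSuperDominationNumber G₃ k₃ → IsSuperDominationNumber H k →
    k ≤ k₁ + k₂ + k₃
  upper-bound γ₁ γ₂ γ₃ γ =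
    let S , wit , le = witnessed-exists (optimal G₁ γ₁ x₁) (optimal G₂ γ₂ x₂) (optimal G₃ γ₃ x₃)
    in  ℕ.≤-trans (minimal H γ wit) le

isγsp : ∀ {n} (G : Graph n) → IsSuperDominationNumber G (γsp G)
isγsp G = proj₂ (superDominationNumber G)

theorem4p2 : ∀ {n₁ n₂ n₃ : ℕ}
    (G₁ : Graph (suc n₁)) (G₂ : Graph (suc n₂)) (G₃ : Graph (suc n₃)) →
    Connected G₁ → Connected G₂ → Connected G₃ →
    (x₁ : Fin (suc n₁)) (x₂ : Fin (suc n₂)) (x₃ : Fin (suc n₃)) →
    ((γsp G₁ + γsp G₂ + γsp G₃) ∸ 2 ≤ γsp (bouquet G₁ x₁ G₂ x₂ G₃ x₃))
    × (γsp (bouquet G₁ x₁ G₂ x₂ G₃ x₃) ≤ γsp G₁ + γsp G₂ + γsp G₃)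
theorem4p2 G₁ G₂ G₃ _ _ _ x₁ x₂ x₃ =
    lower-bound G₁ x₁ G₂ x₂ G₃ x₃ (isγsp G₁) (isγsp G₂) (isγsp G₃) (isγsp (bouquet G₁ x₁ G₂ x₂ G₃ x₃))
  , upper-bound G₁ x₁ G₂ x₂ G₃ x₃ (isγsp G₁) (isγsp G₂) (isγsp G₃) (isγsp (bouquet G₁ x₁ G₂ x₂ G₃ x₃))
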